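{- For every composition $I$ of $n\ge1$, the number of (type A) permutation tableaux of the shape encoded by $I$ is \[ \mathrm{PT}^A_I=\sum_{J\succeq I}(-1)^{\ell(I)-\ell(J)}\,\mathrm{Fact}(J), \] where the sum is over compositions $J$ of $n$ coarser than or equal to $I$ and $\mathrm{Fact}(j_1,\dots,j_p)=p^{j_1}(p-1)^{j_2}\cdots2^{j_{p-1}}1^{j_p}$.
   Context: A composition of $n$ is a sequence $I=(i_1,\dots,i_r)$ of positive integers with sum $n$; $\ell(I)=r$; $\mathrm{Des}(I)=\{i_1,i_1+i_2,\dots,i_1+\dots+i_{r-1}\}$; $J\succeq I$ ($J$ coarser than $I$) means $\mathrm{Des}(J)\subseteq\mathrm{Des}(I)$. Let $k\ge1$ and let $\lambda$ be a Young diagram with exactly $k$ rows (rows of length $0$ allowed) and exactly $n-k$ nonempty columns, drawn in French convention (rows left-justified, longest row at the bottom). Encode $\lambda$ by the composition $I=(i_1,\dots,i_k)$ of $n$ where, for $1\le t\le k$, $i_t-1$ is the number of columns of length $k-t+1$ (a bijection onto compositions of $n$ with $k$ parts). A (type A) permutation tableau of shape $\lambda$ is a filling of the boxes of $\lambda$ with $0$'s and $1$'s such that (1) every column contains at least one $1$, and (2) no box containing a $0$ has both a $1$ below it in the same column and a $1$ to its left in the same row. -}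

module Defs where

open import Data.Fin.Base as Fin using (Fin; toℕ)
open import Data.Fin.Patterns using (0F; 1F)
import Data.Fin.Properties as Fin
open import Data.Integer.Base as ℤ using (ℤ; 0ℤ)
open import Data.List.Base using (List; []; _∷_; _++_; map; filter; foldr; length; lookup; replicate; cartesianProductWith; allFin)
open import Data.List.Properties using (length-++; length-replicate; filter-++; filter-all; filter-none)
open import Data.List.Membership.Propositional using (_∈_)
open import Data.List.Membership.Propositional.Properties using (∈-map⁺; ∈-map⁻; ∈-++⁺ˡ; ∈-++⁺ʳ; ∈-allFin; ∈-cartesianProductWith⁺)
open import Data.List.Relation.Binary.Disjoint.Propositional using (Disjoint)
open import Data.List.Relation.Binary.Subset.Propositional using (_⊆_)
open import Data.List.Relation.Unary.All as All using (All; []; _∷_)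
import Data.List.Relation.Unary.All.Properties as All
open import Data.List.Relation.Unary.AllPairs using (AllPairs; []; _∷_)
open import Data.List.Relation.Unary.Any using (here)
open import Data.List.Relation.Unary.Unique.Propositional using (Unique)
import Data.List.Relation.Unary.Unique.Propositional.Properties as Unique
open import Data.Nat.Base using (ℕ; zero; suc; _+_; _*_; _^_; _∸_; _≤_; _≥_; _<_; z≤n; s≤s)
open import Data.Nat.ListAction using (sum)
import Data.Nat.Properties as ℕ
open import Data.Product.Base using (∃; _×_; _,_)
open import Data.Vec.Base as Vec using (Vec; []; _∷_)
open import Relation.Binary.PropositionalEquality using (_≡_; _≢_; refl; sym; trans; cong; cong₂; subst; module ≡-Reasoning)
open import Relation.Nullary using (¬_; ¬?; Dec; _×-dec_; _→-dec_)
open import Relation.Nullary.Decidable using (map′)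
open import Relation.Unary using (Decidable)
import Data.List.Relation.Binary.Subset.DecPropositional as DecSubset

record Finite (A : Set) : Set where
  field
    elements : List A
    unique   : Unique elements
    complete : ∀ x → x ∈ elements

open Finite public

#_∣_ : {A : Set} {P : A → Set} → Finite A → Decidable P → ℕ
# A ∣ P? = length (filter P? (elements A))

∑_∣_ : {A : Set} {P : A → Set} → Finite A → Decidable P → (A → ℤ) → ℤ
(∑ A ∣ P?) f = foldr ℤ._+_ 0ℤ (map f (filter P? (elements A)))

record Composition (n : ℕ) : Set where
  constructor mkComposition
  field
    parts    : List ℕ
    positive : All (1 ≤_) parts
    total    : sum parts ≡ n

open Composition public

ℓ : ∀ {n} → Composition n → ℕ
ℓ I = length (parts I)

partialSums : List ℕ → List ℕ
partialSums []           = []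
partialSums (i ∷ [])     = []
partialSums (i ∷ j ∷ js) = i ∷ map (i +_) (partialSums (j ∷ js))

Des : ∀ {n} → Composition n → List ℕ
Des I = partialSums (parts I)

infix 4 _⪰_

_⪰_ : ∀ {n} → Composition n → Composition n → Set
J ⪰ I = Des J ⊆ Des I

coarser? : ∀ {n} (I : Composition n) → Decidable (_⪰ I)
coarser? I J = Des J ⊆? Des I
  where open DecSubset ℕ._≟_ using (_⊆?_)

factParts : List ℕ → ℕ
factParts []       = 1
factParts (j ∷ js) = length (j ∷ js) ^ j * factParts js

Fact : ∀ {n} → Composition n → ℕ
Fact J = factParts (parts J)

composition-≡ : ∀ {n} {I J : Composition n} → parts I ≡ parts J → I ≡ J
composition-≡ {I = mkComposition ps p₁ t₁} {mkComposition .ps p₂ t₂} refl =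
  cong₂ (mkComposition ps) (All.irrelevant ℕ.≤-irrelevant p₁ p₂) (ℕ.≡-irrelevant t₁ t₂)

prependOne : ∀ {n} → Composition n → Composition (suc n)
prependOne (mkComposition ps p t) = mkComposition (1 ∷ ps) (s≤s z≤n ∷ p) (cong suc t)

growHead : ∀ {n} → Composition (suc n) → Composition (suc (suc n))
growHead (mkComposition (i ∷ is) (_ ∷ p) t) = mkComposition (suc i ∷ is) (s≤s z≤n ∷ p) (cong suc t)

compositionList : ∀ n → List (Composition n)
compositionList zero          = mkComposition [] [] refl ∷ []
compositionList (suc zero)    = mkComposition (1 ∷ []) (s≤s z≤n ∷ []) refl ∷ []
compositionList (suc (suc n)) =
  map prependOne (compositionList (suc n)) ++ map growHead (compositionList (suc n))

private
  ∷-inj₁ : ∀ {a} {A : Set a} {x y : A} {xs ys} → x ∷ xs ≡ y List.∷ ys → x ≡ y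
  ∷-inj₁ refl = refl

  ∷-inj₂ : ∀ {a} {A : Set a} {x y : A} {xs ys} → x ∷ xs ≡ y List.∷ ys → xs ≡ ys
  ∷-inj₂ refl = refl

  prependOne-injective : ∀ {n} {I J : Composition n} → prependOne I ≡ prependOne J → I ≡ J
  prependOne-injective eq = composition-≡ (∷-inj₂ (cong parts eq))

  growHead-injective : ∀ {n} {I J : Composition (suc n)} → growHead I ≡ growHead J → I ≡ J
  growHead-injective {I = mkComposition (_ ∷ _) (_ ∷ _) _} {mkComposition (_ ∷ _) (_ ∷ _) _} eq =
    composition-≡ (cong₂ _∷_ (ℕ.suc-injective (∷-inj₁ (cong parts eq))) (∷-inj₂ (cong parts eq)))

  prependOne≢growHead : ∀ {n} (I J : Composition (suc n)) → prependOne I ≢ growHead J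
  prependOne≢growHead I (mkComposition (suc _ ∷ _) (_ ∷ _) _) eq with cong parts eq
  ... | ()
  prependOne≢growHead I (mkComposition (zero ∷ _) (() ∷ _) _) eq

  compositionList-unique : ∀ n → Unique (compositionList n)
  compositionList-unique zero          = [] ∷ []
  compositionList-unique (suc zero)    = [] ∷ []
  compositionList-unique (suc (suc n)) =
    Unique.++⁺ (Unique.map⁺ prependOne-injective (compositionList-unique (suc n)))
               (Unique.map⁺ growHead-injective (compositionList-unique (suc n)))
               disjoint
    where
    disjoint : Disjoint (map prependOne (compositionList (suc n))) (map growHead (compositionList (suc n)))
    disjoint (p , q) with ∈-map⁻ prependOne p | ∈-map⁻ growHead q
    ... | I , _ , eq | J , _ , eq′ = prependOne≢growHead I J (trans (sym eq) eq′)

  compositionList-complete : ∀ n (I : Composition n) → I ∈ compositionList n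
  compositionList-complete zero (mkComposition [] [] t) = here (composition-≡ refl)
  compositionList-complete zero (mkComposition (suc _ ∷ _) _ ())
  compositionList-complete zero (mkComposition (zero ∷ _) (() ∷ _) _)
  compositionList-complete (suc n) (mkComposition [] _ ())
  compositionList-complete (suc n) (mkComposition (zero ∷ _) (() ∷ _) _)
  compositionList-complete (suc zero) (mkComposition (suc zero ∷ []) _ _) = here (composition-≡ refl)
  compositionList-complete (suc zero) (mkComposition (suc zero ∷ suc _ ∷ _) _ ())
  compositionList-complete (suc zero) (mkComposition (suc zero ∷ zero ∷ _) (_ ∷ () ∷ _) _)
  compositionList-complete (suc zero) (mkComposition (suc (suc _) ∷ _) _ ())
  compositionList-complete (suc (suc n)) (mkComposition (suc zero ∷ is) (_ ∷ p) t) =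
    ∈-++⁺ˡ (subst (_∈ map prependOne (compositionList (suc n))) (composition-≡ refl)
      (∈-map⁺ prependOne (compositionList-complete (suc n) (mkComposition is p (ℕ.suc-injective t)))))
  compositionList-complete (suc (suc n)) (mkComposition (suc (suc i) ∷ is) (_ ∷ p) t) =
    ∈-++⁺ʳ (map prependOne (compositionList (suc n)))
      (subst (_∈ map growHead (compositionList (suc n))) (composition-≡ refl)
        (∈-map⁺ growHead (compositionList-complete (suc n)
          (mkComposition (suc i ∷ is) (s≤s z≤n ∷ p) (ℕ.suc-injective t)))))

compositions : ∀ n → Finite (Composition n)
compositions n = record
  { elements = compositionList n
  ; unique   = compositionList-unique n
  ; complete = compositionList-complete n
  }

∑⪰ : ∀ {n} → Composition n → (Composition n → ℤ) → ℤ
∑⪰ {n} I = ∑ compositions n ∣ coarser? I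

-- A diagram with k rows (possibly empty ones) and m nonempty columns,
-- given by its column lengths from left to right.  Left-justified rows
-- with the longest at the bottom make every column a bottom-aligned
-- stack and the column lengths weakly decreasing.
record YoungDiagram (k m : ℕ) : Set where
  field
    columns    : List ℕ
    decreasing : AllPairs _≥_ columns
    nonempty   : All (1 ≤_) columns
    fits       : All (_≤ k) columns
    width      : length columns ≡ m

open YoungDiagram public

-- i_t - 1 columns of length k - t + 1, for t = 1, …, k
columnLengths : List ℕ → List ℕ
columnLengths []       = []
columnLengths (i ∷ is) = replicate (i ∸ 1) (length (i ∷ is)) ++ columnLengths is

private
  columnLengths-fits : ∀ is → All (_≤ length is) (columnLengths is)
  columnLengths-fits []       = []
  columnLengths-fits (i ∷ is) =
    All.++⁺ (All.replicate⁺ (i ∸ 1) ℕ.≤-refl) (All.map ℕ.m≤n⇒m≤1+n (columnLengths-fits is))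

  columnLengths-nonempty : ∀ is → All (1 ≤_) (columnLengths is)
  columnLengths-nonempty []       = []
  columnLengths-nonempty (i ∷ is) =
    All.++⁺ (All.replicate⁺ (i ∸ 1) (s≤s z≤n)) (columnLengths-nonempty is)

  replicate-++-decreasing : ∀ m {h hs} → All (_≤ h) hs → AllPairs _≥_ hs → AllPairs _≥_ (replicate m h ++ hs)
  replicate-++-decreasing zero    hs≤h dec = dec
  replicate-++-decreasing (suc m) hs≤h dec =
    All.++⁺ (All.replicate⁺ m ℕ.≤-refl) hs≤h ∷ replicate-++-decreasing m hs≤h dec

  columnLengths-decreasing : ∀ is → AllPairs _≥_ (columnLengths is)
  columnLengths-decreasing []       = []
  columnLengths-decreasing (i ∷ is) =
    replicate-++-decreasing (i ∸ 1) (All.map ℕ.m≤n⇒m≤1+n (columnLengths-fits is)) (columnLengths-decreasing is)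

  columnLengths-width : ∀ {is} → All (1 ≤_) is → length (columnLengths is) + length is ≡ sum is
  columnLengths-width [] = refl
  columnLengths-width {suc i ∷ is} (_ ∷ p) = begin
    length (replicate i k ++ cs) + suc (length is)         ≡⟨ cong (_+ k) (length-++ (replicate i k)) ⟩
    length (replicate i k) + length cs + suc (length is)   ≡⟨ cong (λ z → z + length cs + k) (length-replicate i) ⟩
    i + length cs + suc (length is)                        ≡⟨ ℕ.+-suc (i + length cs) (length is) ⟩
    suc (i + length cs + length is)                        ≡⟨ cong suc (ℕ.+-assoc i (length cs) (length is)) ⟩
    suc (i + (length cs + length is))                      ≡⟨ cong (λ z → suc (i + z)) (columnLengths-width p) ⟩
    suc (i + sum is)                                       ∎
    where
    open ≡-Reasoning
    k = suc (length is)
    cs = columnLengths is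

shape : ∀ {n} (I : Composition n) → YoungDiagram (ℓ I) (n ∸ ℓ I)
shape {n} I = record
  { columns    = columnLengths (parts I)
  ; decreasing = columnLengths-decreasing (parts I)
  ; nonempty   = columnLengths-nonempty (parts I)
  ; fits       = columnLengths-fits (parts I)
  ; width      = trans (sym (ℕ.m+n∸n≡m _ (ℓ I)))
                       (cong (_∸ ℓ I) (trans (columnLengths-width (positive I)) (total I)))
  }

private
  multiplicity : ℕ → List ℕ → ℕ
  multiplicity h hs = length (filter (h ℕ.≟_) hs)

  multiplicity-++ : ∀ h xs ys → multiplicity h (xs ++ ys) ≡ multiplicity h xs + multiplicity h ys
  multiplicity-++ h xs ys = trans (cong length (filter-++ (h ℕ.≟_) xs ys)) (length-++ (filter (h ℕ.≟_) xs))

  multiplicity-none : ∀ {h xs} → All (h ≢_) xs → multiplicity h xs ≡ 0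
  multiplicity-none {h} p = cong length (filter-none (h ℕ.≟_) p)

  multiplicity-replicate : ∀ h m → multiplicity h (replicate m h) ≡ m
  multiplicity-replicate h m =
    trans (cong length (filter-all (h ℕ.≟_) (All.replicate⁺ m refl))) (length-replicate m)

  columnLengths-encodes : ∀ is (t : Fin (length is)) →
                          multiplicity (length is ∸ toℕ t) (columnLengths is) ≡ lookup is t ∸ 1
  columnLengths-encodes (i ∷ is) 0F = begin
    multiplicity k (replicate (i ∸ 1) k ++ cs)                  ≡⟨ multiplicity-++ k (replicate (i ∸ 1) k) cs ⟩
    multiplicity k (replicate (i ∸ 1) k) + multiplicity k cs    ≡⟨ cong₂ _+_ (multiplicity-replicate k (i ∸ 1))
                                                                    (multiplicity-none (All.map (λ c≤ eq → ℕ.<⇒≢ (s≤s c≤) (sym eq)) (columnLengths-fits is))) ⟩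
    i ∸ 1 + 0                                                   ≡⟨ ℕ.+-identityʳ (i ∸ 1) ⟩
    i ∸ 1                                                       ∎
    where
    open ≡-Reasoning
    k = suc (length is)
    cs = columnLengths is
  columnLengths-encodes (i ∷ is) (Fin.suc t) =
    trans (multiplicity-++ h (replicate (i ∸ 1) (suc (length is))) (columnLengths is))
      (cong₂ _+_ (multiplicity-none (All.replicate⁺ (i ∸ 1) (ℕ.<⇒≢ (s≤s (ℕ.m∸n≤m (length is) (toℕ t))))))
                 (columnLengths-encodes is t))
    where h = length is ∸ toℕ t

-- Parts of I are indexed from 0 here, so the length k - t + 1 becomes k - toℕ t.
shape-encodes : ∀ {n} (I : Composition n) (t : Fin (ℓ I)) →
                length (filter ((ℓ I ∸ toℕ t) ℕ.≟_) (columns (shape I))) ≡ lookup (parts I) t ∸ 1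
shape-encodes I = columnLengths-encodes (parts I)

-- One vector of entries per column, each listed from bottom to top.
ColumnFilling : List ℕ → Set
ColumnFilling = All (Vec (Fin 2))

column : ∀ {hs} → ColumnFilling hs → (c : Fin (length hs)) → Vec (Fin 2) (lookup hs c)
column (v ∷ vs) 0F          = v
column (v ∷ vs) (Fin.suc c) = column vs c

module _ {k m : ℕ} (D : YoungDiagram k m) where

  Filling : Set
  Filling = ColumnFilling (columns D)

  Col : Set
  Col = Fin (length (columns D))

  Box : Col → Set
  Box c = Fin (lookup (columns D) c)

  module _ (T : Filling) where

    entry : (c : Col) → Box c → Fin 2
    entry c r = Vec.lookup (column T c) r

    OneBelow : (c : Col) → Box c → Set
    OneBelow c r = ∃ λ (r′ : Box c) → r′ Fin.< r × entry c r′ ≡ 1F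

    OneToTheLeft : (c : Col) → Box c → Set
    OneToTheLeft c r = ∃ λ (c′ : Col) → c′ Fin.< c × ∃ λ (r′ : Box c′) → toℕ r′ ≡ toℕ r × entry c′ r′ ≡ 1F

    record IsPermutationTableau : Set where
      constructor mkPT
      field
        columnHasOne : ∀ c → ∃ λ r → entry c r ≡ 1F
        zeroAllowed  : ∀ c r → entry c r ≡ 0F → ¬ (OneBelow c r × OneToTheLeft c r)

  isPermutationTableau? : Decidable IsPermutationTableau
  isPermutationTableau? T =
    map′ (λ (p , q) → mkPT p q) (λ (mkPT p q) → p , q)
      (Fin.all? (λ c → Fin.any? λ r → entry T c r Fin.≟ 1F)
       ×-dec
       Fin.all? (λ c → Fin.all? λ r → entry T c r Fin.≟ 0F →-dec ¬? (oneBelow? c r ×-dec oneToTheLeft? c r)))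
    where
    oneBelow? : ∀ c r → Dec (OneBelow T c r)
    oneBelow? c r = Fin.any? λ r′ → r′ Fin.<? r ×-dec entry T c r′ Fin.≟ 1F

    oneToTheLeft? : ∀ c r → Dec (OneToTheLeft T c r)
    oneToTheLeft? c r = Fin.any? λ c′ → c′ Fin.<? c ×-dec
      Fin.any? λ r′ → toℕ r′ ℕ.≟ toℕ r ×-dec entry T c′ r′ Fin.≟ 1F

finiteVec : {A : Set} → Finite A → ∀ h → Finite (Vec A h)
finiteVec A zero    = record
  { elements = [] ∷ [] ; unique = [] ∷ [] ; complete = λ { [] → here refl } }
finiteVec A (suc h) = record
  { elements = cartesianProductWith _∷_ (elements A) (elements (finiteVec A h))
  ; unique   = Unique.cartesianProductWith⁺ _∷_ (λ { refl → refl , refl }) (unique A) (unique (finiteVec A h))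
  ; complete = λ { (x ∷ xs) → ∈-cartesianProductWith⁺ _∷_ (complete A x) (complete (finiteVec A h) xs) }
  }

finiteFin : ∀ n → Finite (Fin n)
finiteFin n = record { elements = allFin n ; unique = Unique.allFin⁺ n ; complete = ∈-allFin }

finiteAll : {A : Set} {P : A → Set} → (∀ x → Finite (P x)) → ∀ xs → Finite (All P xs)
finiteAll P []       = record
  { elements = [] ∷ [] ; unique = [] ∷ [] ; complete = λ { [] → here refl } }
finiteAll P (x ∷ xs) = record
  { elements = cartesianProductWith _∷_ (elements (P x)) (elements (finiteAll P xs))
  ; unique   = Unique.cartesianProductWith⁺ _∷_ (λ { refl → refl , refl }) (unique (P x)) (unique (finiteAll P xs))
  ; complete = λ { (p ∷ ps) → ∈-cartesianProductWith⁺ _∷_ (complete (P x) p) (complete (finiteAll P xs) ps) }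
  }

fillings : ∀ {k m} (D : YoungDiagram k m) → Finite (Filling D)
fillings D = finiteAll (finiteVec (finiteFin 2)) (columns D)

PTᴬ : ∀ {n} → Composition n → ℕ
PTᴬ I = # fillings (shape I) ∣ isPermutationTableau? (shape I)

{-# OPTIONS --safe #-}
-- Call a row of a filling free if it holds no 0 with a 1 below it in its column.
-- Build a tableau from right to left.  A new leftmost column has its 1's in free
-- rows only, and needs at least one; a new top row is free.  Hence the polynomial
-- counting tableaux by x ^ (number of free rows) is transformed by
--   X f (x) = x f(x)            for a new row, and
--   D f (x) = x (f(x+1) - f(x)) for a new column.
-- Write X = E - D with E f (x) = x f(x+1), at each position of Des(I), and expand.
-- On rising factorials R_p = x (x+1) ... (x+p-1) one has E R_p = R_(p+1) and
-- D R_p = p R_p, so the word with E exactly at Des(J) contributes a multiple of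
-- R_ℓ(J) whose value at x = 1 is Fact(J).
module Submission where

open import Defs
open import Data.Bool.Base using (Bool; true; false; not; _∧_; T; if_then_else_)
open import Data.Bool.Properties using (T-∧; T?)
open import Data.Empty using (⊥-elim)
open import Data.Fin.Base as Fin using (Fin; toℕ)
open import Data.Fin.Patterns using (0F; 1F)
open import Data.Integer.Base using (ℤ; 0ℤ; 1ℤ; +_; -1ℤ; _+_; _-_; _*_; _^_)
import Data.Integer.Properties as ℤ
open import Data.Integer.Tactic.RingSolver using (solve-∀)
open import Data.List.Base using (List; []; _∷_; _++_; map; filter; foldr; length; cartesianProductWith)
open import Data.List.Membership.Propositional using (_∈_)
open import Data.List.Membership.Propositional.Properties using (∈-map⁺; ∈-map⁻; ∈-++⁻)
open import Data.List.Properties using (map-∘)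
open import Data.List.Relation.Binary.Subset.Propositional using (_⊆_)
open import Data.List.Relation.Binary.Subset.Propositional.Properties using (map⁺; ∷⁺ʳ)
open import Data.List.Relation.Unary.All as All using (All; []; _∷_)
import Data.List.Relation.Unary.All.Properties as All
open import Data.List.Relation.Unary.Any using (here; there)
open import Data.Nat.Base as ℕ using (ℕ; zero; suc; _≤_; _∸_; _!; s≤s; z<s; s<s)
import Data.Nat.Properties as ℕ
import Data.Nat.Tactic.RingSolver as ℕ-Solver
open import Data.Product.Base using (∃; _×_; _,_; proj₁; proj₂)
open import Data.Sum.Base using (inj₁; inj₂)
open import Data.Unit.Base using (tt)
open import Data.Vec.Base as Vec using (Vec; []; _∷_)
open import Function.Base using (_∘_)
open import Function.Bundles using (_⇔_; mk⇔; module Equivalence)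
open import Relation.Binary.PropositionalEquality using (_≡_; refl; sym; trans; cong; cong₂; subst; module ≡-Reasoning)
open import Relation.Nullary using (¬_; Dec; yes; no; does; contradiction)
open import Relation.Nullary.Decidable using (does-⇔)
open import Relation.Unary using (Decidable)

open Equivalence using (to; from)
open ≡-Reasoning

private
  variable
    A B C : Set

-- Finite sums of integers

*-exchange : ∀ a b c → a * (b * c) ≡ b * (a * c)
*-exchange = solve-∀

∑ : List A → (A → ℤ) → ℤ
∑ xs f = foldr _+_ 0ℤ (map f xs)

𝟙 : Bool → ℤ
𝟙 b = if b then 1ℤ else 0ℤ

𝟙-∧ : ∀ b c → 𝟙 (b ∧ c) ≡ 𝟙 b * 𝟙 c
𝟙-∧ true  c = sym (ℤ.*-identityˡ (𝟙 c))
𝟙-∧ false c = sym (ℤ.*-zeroˡ (𝟙 c))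

-- Allows a fact that depends on `J ⪰ I` to be used under a sum over all compositions: where the
-- condition fails, both products vanish.
𝟙-*-cong : ∀ {P : Set} (P? : Dec P) {y z} → (P → y ≡ z) → 𝟙 (does P?) * y ≡ 𝟙 (does P?) * z
𝟙-*-cong (yes p) eq = cong (1ℤ *_) (eq p)
𝟙-*-cong (no _)  {y} {z} eq = trans (ℤ.*-zeroˡ y) (sym (ℤ.*-zeroˡ z))

∑-cong : ∀ (xs : List A) {f g} → (∀ x → f x ≡ g x) → ∑ xs f ≡ ∑ xs g
∑-cong []       f≗g = refl
∑-cong (x ∷ xs) f≗g = cong₂ _+_ (f≗g x) (∑-cong xs f≗g)

∑-++ : ∀ (xs ys : List A) f → ∑ (xs ++ ys) f ≡ ∑ xs f + ∑ ys f
∑-++ []       ys f = sym (ℤ.+-identityˡ _)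
∑-++ (x ∷ xs) ys f = trans (cong (_+_ (f x)) (∑-++ xs ys f)) (sym (ℤ.+-assoc (f x) (∑ xs f) (∑ ys f)))

∑-map : ∀ (g : A → B) xs f → ∑ (map g xs) f ≡ ∑ xs (f ∘ g)
∑-map g xs f = cong (foldr _+_ 0ℤ) (sym (map-∘ xs))

∑-zero : ∀ (xs : List A) → ∑ xs (λ _ → 0ℤ) ≡ 0ℤ
∑-zero []       = refl
∑-zero (x ∷ xs) = trans (ℤ.+-identityˡ _) (∑-zero xs)

∑-+ : ∀ (xs : List A) f g → ∑ xs (λ x → f x + g x) ≡ ∑ xs f + ∑ xs g
∑-+ []       f g = refl
∑-+ (x ∷ xs) f g = trans (cong (_+_ (f x + g x)) (∑-+ xs f g)) (interchange (f x) (g x) (∑ xs f) (∑ xs g))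
  where
  interchange : ∀ a b c d → a + b + (c + d) ≡ a + c + (b + d)
  interchange = solve-∀

∑-*ˡ : ∀ (xs : List A) a f → ∑ xs (λ x → a * f x) ≡ a * ∑ xs f
∑-*ˡ []       a f = sym (ℤ.*-zeroʳ a)
∑-*ˡ (x ∷ xs) a f = trans (cong (_+_ (a * f x)) (∑-*ˡ xs a f)) (sym (ℤ.*-distribˡ-+ a (f x) (∑ xs f)))

∑-difference : ∀ (xs : List A) a f g → ∑ xs (λ x → a * (f x - g x)) ≡ a * (∑ xs f - ∑ xs g)
∑-difference []       a f g = sym (ℤ.*-zeroʳ a)
∑-difference (x ∷ xs) a f g =
  trans (cong (_+_ (a * (f x - g x))) (∑-difference xs a f g)) (collect a (f x) (g x) (∑ xs f) (∑ xs g))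
  where
  collect : ∀ a b c d e → a * (b - c) + a * (d - e) ≡ a * (b + d - (c + e))
  collect = solve-∀

∑-swap : ∀ (xs : List A) (ys : List B) (f : A → B → ℤ) → ∑ xs (λ x → ∑ ys (f x)) ≡ ∑ ys (λ y → ∑ xs (λ x → f x y))
∑-swap []       ys f = sym (∑-zero ys)
∑-swap (x ∷ xs) ys f =
  trans (cong (_+_ (∑ ys (f x))) (∑-swap xs ys f)) (sym (∑-+ ys (f x) (λ y → ∑ xs (λ x′ → f x′ y))))

∑-cartesianProductWith : ∀ (g : A → B → C) xs ys f →
                         ∑ (cartesianProductWith g xs ys) f ≡ ∑ xs (λ x → ∑ ys (λ y → f (g x y)))
∑-cartesianProductWith g []       ys f = refl
∑-cartesianProductWith g (x ∷ xs) ys f =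
  trans (∑-++ (map (g x) ys) (cartesianProductWith g xs ys) f)
        (cong₂ _+_ (∑-map (g x) ys f) (∑-cartesianProductWith g xs ys f))

∑-filter : ∀ {P : A → Set} (P? : Decidable P) xs f →
           ∑ (filter P? xs) f ≡ ∑ xs (λ x → 𝟙 (does (P? x)) * f x)
∑-filter P? []       f = refl
∑-filter P? (x ∷ xs) f with does (P? x)
... | true  = cong₂ _+_ (sym (ℤ.*-identityˡ (f x))) (∑-filter P? xs f)
... | false = trans (∑-filter P? xs f) (sym (ℤ.+-identityˡ _))

length-filter : ∀ {P : A → Set} (P? : Decidable P) xs →
                + length (filter P? xs) ≡ ∑ xs (λ x → 𝟙 (does (P? x)))
length-filter P? []       = refl
length-filter P? (x ∷ xs) with does (P? x)
... | true  = trans (ℤ.pos-+ 1 (length (filter P? xs))) (cong (_+_ 1ℤ) (length-filter P? xs))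
... | false = trans (length-filter P? xs) (sym (ℤ.+-identityˡ _))

-- Boolean description of permutation tableaux

hasOne : ∀ {h} → Vec (Fin 2) h → Bool
hasOne []       = false
hasOne (0F ∷ v) = hasOne v
hasOne (1F ∷ v) = true

onesWithin : ∀ {h} → (ℕ → Bool) → Vec (Fin 2) h → Bool
onesWithin f []       = true
onesWithin f (0F ∷ v) = onesWithin (f ∘ suc) v
onesWithin f (1F ∷ v) = f 0 ∧ onesWithin (f ∘ suc) v

-- Row r does not hold a 0 with a 1 below it; the flag says whether a 1 has
-- already been passed below the entries of the vector.
clear : ∀ {h} → Bool → Vec (Fin 2) h → ℕ → Bool
clear s []       r       = true
clear s (0F ∷ v) zero    = not s
clear s (1F ∷ v) zero    = true
clear s (0F ∷ v) (suc r) = clear s v r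
clear s (1F ∷ v) (suc r) = clear true v r

-- Rows are natural numbers, so that columns of different heights share one predicate. A row above
-- the top of a column counts as clear in that column.
free : ∀ {hs} → ColumnFilling hs → ℕ → Bool
free []      r = true
free (v ∷ t) r = free t r ∧ clear false v r

valid : ∀ {hs} → ColumnFilling hs → Bool
valid []      = true
valid (v ∷ t) = valid t ∧ (hasOne v ∧ onesWithin (free t) v)

hasOne-⇔ : ∀ {h} (v : Vec (Fin 2) h) → T (hasOne v) ⇔ (∃ λ r → Vec.lookup v r ≡ 1F)
hasOne-⇔ v = mk⇔ (⇒ v) (⇐ v)
  where
  ⇒ : ∀ {h} (v : Vec (Fin 2) h) → T (hasOne v) → ∃ λ r → Vec.lookup v r ≡ 1F
  ⇒ (0F ∷ v) p with r , eq ← ⇒ v p = Fin.suc r , eq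
  ⇒ (1F ∷ v) p = 0F , refl

  ⇐ : ∀ {h} (v : Vec (Fin 2) h) → (∃ λ r → Vec.lookup v r ≡ 1F) → T (hasOne v)
  ⇐ (0F ∷ v) (Fin.suc r , eq) = ⇐ v (r , eq)
  ⇐ (1F ∷ v) _                = tt

onesWithin-⇔ : ∀ {h} f (v : Vec (Fin 2) h) →
               T (onesWithin f v) ⇔ (∀ r → Vec.lookup v r ≡ 1F → T (f (toℕ r)))
onesWithin-⇔ f v = mk⇔ (⇒ f v) (⇐ f v)
  where
  ⇒ : ∀ {h} f (v : Vec (Fin 2) h) → T (onesWithin f v) → ∀ r → Vec.lookup v r ≡ 1F → T (f (toℕ r))
  ⇒ f (0F ∷ v) p (Fin.suc r) eq = ⇒ (f ∘ suc) v p r eq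
  ⇒ f (1F ∷ v) p 0F          eq = proj₁ (to T-∧ p)
  ⇒ f (1F ∷ v) p (Fin.suc r) eq = ⇒ (f ∘ suc) v (proj₂ (to T-∧ p)) r eq

  ⇐ : ∀ {h} f (v : Vec (Fin 2) h) → (∀ r → Vec.lookup v r ≡ 1F → T (f (toℕ r))) → T (onesWithin f v)
  ⇐ f []       p = tt
  ⇐ f (0F ∷ v) p = ⇐ (f ∘ suc) v (p ∘ Fin.suc)
  ⇐ f (1F ∷ v) p = from T-∧ (p 0F refl , ⇐ (f ∘ suc) v (p ∘ Fin.suc))

ZeroAboveOne : ∀ {h} → Vec (Fin 2) h → Fin h → Set
ZeroAboveOne v r = Vec.lookup v r ≡ 0F × ∃ λ r′ → r′ Fin.< r × Vec.lookup v r′ ≡ 1F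

-- With a 1 already passed, every later 0 has a 1 below it, so a clear row can only hold a 1.
clear-true-⇒ : ∀ {h} (v : Vec (Fin 2) h) r → T (clear true v (toℕ r)) → ¬ (Vec.lookup v r ≡ 0F)
clear-true-⇒ (1F ∷ v) 0F          p ()
clear-true-⇒ (0F ∷ v) (Fin.suc r) p eq = clear-true-⇒ v r p eq
clear-true-⇒ (1F ∷ v) (Fin.suc r) p eq = clear-true-⇒ v r p eq

clear-true-⇐ : ∀ {h} (v : Vec (Fin 2) h) r → (∀ q → toℕ q ≡ r → ¬ (Vec.lookup v q ≡ 0F)) → T (clear true v r)
clear-true-⇐ []       r       p = tt
clear-true-⇐ (0F ∷ v) zero    p = contradiction refl (p 0F refl)
clear-true-⇐ (1F ∷ v) zero    p = tt
clear-true-⇐ (0F ∷ v) (suc r) p = clear-true-⇐ v r (λ q eq → p (Fin.suc q) (cong suc eq))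
clear-true-⇐ (1F ∷ v) (suc r) p = clear-true-⇐ v r (λ q eq → p (Fin.suc q) (cong suc eq))

clear-⇔ : ∀ {h} (v : Vec (Fin 2) h) r →
          T (clear false v r) ⇔ (∀ q → toℕ q ≡ r → ¬ ZeroAboveOne v q)
clear-⇔ v r = mk⇔ (λ p q eq → ⇒ v q (subst (T ∘ clear false v) (sym eq) p)) (⇐ v r)
  where
  ⇒ : ∀ {h} (v : Vec (Fin 2) h) q → T (clear false v (toℕ q)) → ¬ ZeroAboveOne v q
  ⇒ (0F ∷ v) (Fin.suc q) p (eq , Fin.suc r′ , s<s r′<q , eq′) = ⇒ v q p (eq , r′ , r′<q , eq′)
  ⇒ (1F ∷ v) (Fin.suc q) p (eq , _)                           = clear-true-⇒ v q p eq

  ⇐ : ∀ {h} (v : Vec (Fin 2) h) r → (∀ q → toℕ q ≡ r → ¬ ZeroAboveOne v q) → T (clear false v r)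
  ⇐ []       r       p = tt
  ⇐ (0F ∷ v) zero    p = tt
  ⇐ (1F ∷ v) zero    p = tt
  ⇐ (0F ∷ v) (suc r) p =
    ⇐ v r (λ q eq (z , r′ , r′<q , o) → p (Fin.suc q) (cong suc eq) (z , Fin.suc r′ , s<s r′<q , o))
  ⇐ (1F ∷ v) (suc r) p =
    clear-true-⇐ v r (λ q eq z → p (Fin.suc q) (cong suc eq) (z , 0F , z<s , refl))

free-⇔ : ∀ {hs} (t : ColumnFilling hs) r →
         T (free t r) ⇔ (∀ c q → toℕ q ≡ r → ¬ ZeroAboveOne (column t c) q)
free-⇔ t r = mk⇔ (⇒ t) (⇐ t)
  where
  ⇒ : ∀ {hs} (t : ColumnFilling hs) → T (free t r) → ∀ c q → toℕ q ≡ r → ¬ ZeroAboveOne (column t c) q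
  ⇒ (v ∷ t) p 0F          = to (clear-⇔ v r) (proj₂ (to T-∧ p))
  ⇒ (v ∷ t) p (Fin.suc c) = ⇒ t (proj₁ (to T-∧ p)) c

  ⇐ : ∀ {hs} (t : ColumnFilling hs) → (∀ c q → toℕ q ≡ r → ¬ ZeroAboveOne (column t c) q) → T (free t r)
  ⇐ []      p = tt
  ⇐ (v ∷ t) p = from T-∧ (⇐ t (p ∘ Fin.suc) , from (clear-⇔ v r) (p 0F))

-- The two tableau conditions are restated over a bare list of heights, so that induction can strip
-- the leftmost column without rebuilding a diagram.
HasOnes : ∀ {hs} → ColumnFilling hs → Set
HasOnes t = ∀ c → ∃ λ r → Vec.lookup (column t c) r ≡ 1F

ZerosAllowed : ∀ {hs} → ColumnFilling hs → Set
ZerosAllowed {hs} t = ∀ c r → Vec.lookup (column t c) r ≡ 0F →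
  ¬ ((∃ λ r′ → r′ Fin.< r × Vec.lookup (column t c) r′ ≡ 1F) ×
     (∃ λ (c′ : Fin (length hs)) → c′ Fin.< c × ∃ λ r′ → toℕ r′ ≡ toℕ r × Vec.lookup (column t c′) r′ ≡ 1F))

-- A new leftmost column has nothing to its left, so its own 0's are harmless. It can only spoil a 0
-- of `t` that lies in the row of one of its 1's and has a 1 below it, which is why its 1's must sit
-- in free rows of `t`.
valid-⇔ : ∀ {hs} (t : ColumnFilling hs) → T (valid t) ⇔ (HasOnes t × ZerosAllowed t)
valid-⇔ []      = mk⇔ (λ _ → (λ ()) , (λ ())) (λ _ → tt)
valid-⇔ (v ∷ t) = mk⇔ ⇒ ⇐
  where
  ⇒ : T (valid (v ∷ t)) → HasOnes (v ∷ t) × ZerosAllowed (v ∷ t)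
  ⇒ p = ones , zeros
    where
    valid-t = to (valid-⇔ t) (proj₁ (to (T-∧ {valid t}) p))
    valid-v = to (T-∧ {hasOne v}) (proj₂ (to (T-∧ {valid t}) p))

    ones : HasOnes (v ∷ t)
    ones 0F          = to (hasOne-⇔ v) (proj₁ valid-v)
    ones (Fin.suc c) = proj₁ valid-t c

    zeros : ZerosAllowed (v ∷ t)
    -- No clause treats column `0F`: no column precedes it.
    zeros (Fin.suc c) r eq (below , 0F , _ , r′ , r′≡r , eq′) =
      to (free-⇔ t (toℕ r′)) (to (onesWithin-⇔ (free t) v) (proj₂ valid-v) r′ eq′) c r (sym r′≡r) (eq , below)
    zeros (Fin.suc c) r eq (below , Fin.suc c′ , s<s c′<c , left) =
      proj₂ valid-t c r eq (below , c′ , c′<c , left)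

  ⇐ : HasOnes (v ∷ t) × ZerosAllowed (v ∷ t) → T (valid (v ∷ t))
  ⇐ (ones , zeros) = from T-∧
    ( from (valid-⇔ t) (ones ∘ Fin.suc , λ c r eq (below , c′ , c′<c , left) →
        zeros (Fin.suc c) r eq (below , Fin.suc c′ , s<s c′<c , left))
    , from T-∧
      ( from (hasOne-⇔ v) (ones 0F)
      , from (onesWithin-⇔ (free t) v) (λ r′ eq′ → from (free-⇔ t (toℕ r′))
          (λ c q q≡r′ (eq , below) → zeros (Fin.suc c) q eq (below , 0F , z<s , r′ , sym q≡r′ , eq′)))))

isPermutationTableau-valid : ∀ {k m} (D : YoungDiagram k m) (t : Filling D) →
                             does (isPermutationTableau? D t) ≡ valid t
isPermutationTableau-valid D t = does-⇔
  (mk⇔ (λ (mkPT p q) → from (valid-⇔ t) (p , q))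
       (λ p → let q = to (valid-⇔ t) p in mkPT (proj₁ q) (proj₂ q)))
  (isPermutationTableau? D t) (T? (valid t))

-- Enumeration by the number of free rows

factor : ℤ → Bool → ℤ
factor x b = if b then x else 1ℤ

-- The power of `x` whose exponent counts the rows below `k` that satisfy `f`, kept as a product so
-- that rows are peeled off from the bottom together with the entries of a column.
weight : ℤ → ℕ → (ℕ → Bool) → ℤ
weight x zero    f = 1ℤ
weight x (suc k) f = factor x (f 0) * weight x k (f ∘ suc)

weight-one : ∀ k f → weight 1ℤ k f ≡ 1ℤ
weight-one zero    f = refl
weight-one (suc k) f with f 0
... | true  = trans (ℤ.*-identityˡ _) (weight-one k (f ∘ suc))
... | false = trans (ℤ.*-identityˡ _) (weight-one k (f ∘ suc))

weight-top : ∀ x k f → T (f k) → weight x (suc k) f ≡ x * weight x k f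
weight-top x zero    f p with true ← f 0 = refl
weight-top x (suc k) f p = trans (cong (factor x (f 0) *_) (weight-top x k (f ∘ suc) p)) (*-exchange (factor x (f 0)) x _)

-- Sums over the fillings of one column

columnList : ∀ h → List (Vec (Fin 2) h)
columnList h = elements (finiteVec (finiteFin 2) h)

∑-columnList-suc : ∀ h f → ∑ (columnList (suc h)) f ≡ ∑ (columnList h) (f ∘ (0F ∷_)) + ∑ (columnList h) (f ∘ (1F ∷_))
∑-columnList-suc h f = trans (∑-cartesianProductWith _∷_ (0F ∷ 1F ∷ []) (columnList h) f)
  (cong (_+_ (∑ (columnList h) (f ∘ (0F ∷_)))) (ℤ.+-identityʳ _))

∑-*-middle : ∀ (xs : List A) a (f g : A → ℤ) → ∑ xs (λ x → f x * (a * g x)) ≡ a * ∑ xs (λ x → f x * g x)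
∑-*-middle xs a f g = trans (∑-cong xs (λ x → *-exchange (f x) a (g x))) (∑-*ˡ xs a (λ x → f x * g x))

-- Above a 1, each free row independently takes a 1 and stays free (factor `x`) or a 0 and is lost
-- (factor 1). A row that is not free must take 0, with factor 1.
∑-columnsAboveOne : ∀ x h f →
  ∑ (columnList h) (λ v → 𝟙 (onesWithin f v) * weight x h (λ r → f r ∧ clear true v r)) ≡ weight (1ℤ + x) h f
∑-columnsAboveOne x zero    f = refl
∑-columnsAboveOne x (suc h) f
  rewrite ∑-columnList-suc h (λ v → 𝟙 (onesWithin f v) * weight x (suc h) (λ r → f r ∧ clear true v r))
  with f 0
... | true  = begin
  ∑ vs (λ v → a v * (1ℤ * w v)) + ∑ vs (λ v → a v * (x * w v))
    ≡⟨ cong₂ _+_ (∑-*-middle vs 1ℤ a w) (∑-*-middle vs x a w) ⟩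
  1ℤ * ∑ vs (λ v → a v * w v) + x * ∑ vs (λ v → a v * w v)
    ≡⟨ ℤ.*-distribʳ-+ (∑ vs (λ v → a v * w v)) 1ℤ x ⟨
  (1ℤ + x) * ∑ vs (λ v → a v * w v)
    ≡⟨ cong ((1ℤ + x) *_) (∑-columnsAboveOne x h (f ∘ suc)) ⟩
  (1ℤ + x) * weight (1ℤ + x) h (f ∘ suc) ∎
  where
  vs = columnList h
  a  = λ (v : Vec (Fin 2) h) → 𝟙 (onesWithin (f ∘ suc) v)
  w  = λ (v : Vec (Fin 2) h) → weight x h (λ r → f (suc r) ∧ clear true v r)
... | false = begin
  ∑ vs (λ v → a v * (1ℤ * w v)) + ∑ vs (λ v → 0ℤ * (1ℤ * w v))
    ≡⟨ cong₂ _+_ (∑-*-middle vs 1ℤ a w) (trans (∑-cong vs (λ v → ℤ.*-zeroˡ (1ℤ * w v))) (∑-zero vs)) ⟩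
  1ℤ * ∑ vs (λ v → a v * w v) + 0ℤ
    ≡⟨ ℤ.+-identityʳ _ ⟩
  1ℤ * ∑ vs (λ v → a v * w v)
    ≡⟨ cong (1ℤ *_) (∑-columnsAboveOne x h (f ∘ suc)) ⟩
  1ℤ * weight (1ℤ + x) h (f ∘ suc) ∎
  where
  vs = columnList h
  a  = λ (v : Vec (Fin 2) h) → 𝟙 (onesWithin (f ∘ suc) v)
  w  = λ (v : Vec (Fin 2) h) → weight x h (λ r → f (suc r) ∧ clear true v r)

-- With m free rows and the lowest 1 in the j-th of them, the 0's below leave their rows free and
-- the rows above contribute as in `∑-columnsAboveOne`. The total is the sum of x^j (1+x)^(m-j) over
-- j from 1 to m, a geometric sum equal to x ((1+x)^m - x^m). The induction splits on the bottom
-- entry instead of summing over j.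
∑-columns : ∀ x h f →
  ∑ (columnList h) (λ v → 𝟙 (hasOne v ∧ onesWithin f v) * weight x h (λ r → f r ∧ clear false v r))
    ≡ x * (weight (1ℤ + x) h f - weight x h f)
∑-columns x zero    f = sym (ℤ.*-zeroʳ x)
∑-columns x (suc h) f
  rewrite ∑-columnList-suc h (λ v → 𝟙 (hasOne v ∧ onesWithin f v) * weight x (suc h) (λ r → f r ∧ clear false v r))
  with f 0
... | true  = begin
  ∑ vs (λ v → a v * (x * w v)) + ∑ vs (λ v → a′ v * (x * w′ v))
    ≡⟨ cong₂ _+_ (∑-*-middle vs x a w) (∑-*-middle vs x a′ w′) ⟩
  x * ∑ vs (λ v → a v * w v) + x * ∑ vs (λ v → a′ v * w′ v)
    ≡⟨ cong₂ (λ y z → x * y + x * z) (∑-columns x h (f ∘ suc)) (∑-columnsAboveOne x h (f ∘ suc)) ⟩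
  x * (x * (W⁺ - W)) + x * W⁺
    ≡⟨ collect x W⁺ W ⟩
  x * ((1ℤ + x) * W⁺ - x * W) ∎
  where
  vs = columnList h
  a  = λ (v : Vec (Fin 2) h) → 𝟙 (hasOne v ∧ onesWithin (f ∘ suc) v)
  a′ = λ (v : Vec (Fin 2) h) → 𝟙 (onesWithin (f ∘ suc) v)
  w  = λ (v : Vec (Fin 2) h) → weight x h (λ r → f (suc r) ∧ clear false v r)
  w′ = λ (v : Vec (Fin 2) h) → weight x h (λ r → f (suc r) ∧ clear true v r)
  W  = weight x h (f ∘ suc)
  W⁺ = weight (1ℤ + x) h (f ∘ suc)

  collect : ∀ x p q → x * (x * (p - q)) + x * p ≡ x * ((1ℤ + x) * p - x * q)
  collect = solve-∀
... | false = begin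
  ∑ vs (λ v → a v * (1ℤ * w v)) + ∑ vs (λ v → 0ℤ * (1ℤ * w′ v))
    -- A bottom 1 in a row that is not free is forbidden, so the second sum vanishes.
    ≡⟨ cong₂ _+_ (∑-*-middle vs 1ℤ a w) (trans (∑-cong vs (λ v → ℤ.*-zeroˡ (1ℤ * w′ v))) (∑-zero vs)) ⟩
  1ℤ * ∑ vs (λ v → a v * w v) + 0ℤ
    ≡⟨ cong (λ y → 1ℤ * y + 0ℤ) (∑-columns x h (f ∘ suc)) ⟩
  1ℤ * (x * (W⁺ - W)) + 0ℤ
    ≡⟨ collect x W⁺ W ⟩
  x * (1ℤ * W⁺ - 1ℤ * W) ∎
  where
  vs = columnList h
  a  = λ (v : Vec (Fin 2) h) → 𝟙 (hasOne v ∧ onesWithin (f ∘ suc) v)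
  w  = λ (v : Vec (Fin 2) h) → weight x h (λ r → f (suc r) ∧ clear false v r)
  w′ = λ (v : Vec (Fin 2) h) → weight x h (λ r → f (suc r) ∧ clear true v r)
  W  = weight x h (f ∘ suc)
  W⁺ = weight (1ℤ + x) h (f ∘ suc)

  collect : ∀ x p q → 1ℤ * (x * (p - q)) + 0ℤ ≡ x * (1ℤ * p - 1ℤ * q)
  collect = solve-∀

-- Adding a row or a column to a tableau

fillingList : ∀ hs → List (ColumnFilling hs)
fillingList hs = elements (finiteAll (finiteVec (finiteFin 2)) hs)

freeRowPolynomial : ℕ → List ℕ → ℤ → ℤ
freeRowPolynomial k hs x = ∑ (fillingList hs) (λ t → 𝟙 (valid t) * weight x k (free t))

clear-high : ∀ {h} s (v : Vec (Fin 2) h) {r} → h ≤ r → T (clear s v r)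
clear-high s []       h≤r       = tt
clear-high s (0F ∷ v) (s≤s h≤r) = clear-high s v h≤r
clear-high s (1F ∷ v) (s≤s h≤r) = clear-high true v h≤r

free-high : ∀ {hs k} (t : ColumnFilling hs) → All (_≤ k) hs → T (free t k)
free-high []      []           = tt
free-high (v ∷ t) (h≤k ∷ hs≤k) = from T-∧ (free-high t hs≤k , clear-high false v h≤k)

-- Validity does not involve `k`, so the tableaux stay the same. The new row lies above every
-- column, hence is free and contributes one factor `x`.
freeRowPolynomial-emptyRow : ∀ k {hs} x → All (_≤ k) hs →
                             freeRowPolynomial (suc k) hs x ≡ x * freeRowPolynomial k hs x
freeRowPolynomial-emptyRow k {hs} x hs≤k =
  trans (∑-cong (fillingList hs) (λ t → cong (𝟙 (valid t) *_) (weight-top x k (free t) (free-high t hs≤k))))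
        (∑-*-middle (fillingList hs) x (𝟙 ∘ valid) (weight x k ∘ free))

freeRowPolynomial-column : ∀ k hs x → freeRowPolynomial k (k ∷ hs) x
                         ≡ x * (freeRowPolynomial k hs (1ℤ + x) - freeRowPolynomial k hs x)
freeRowPolynomial-column k hs x = begin
  freeRowPolynomial k (k ∷ hs) x
    ≡⟨ ∑-cartesianProductWith _∷_ vs ts _ ⟩
  ∑ vs (λ v → ∑ ts (λ t → 𝟙 (valid (v ∷ t)) * weight x k (free (v ∷ t))))
    -- The old columns `t` are fixed first, since the admissible new columns depend on `t` through
    -- its free rows.
    ≡⟨ ∑-swap vs ts _ ⟩
  ∑ ts (λ t → ∑ vs (λ v → 𝟙 (valid (v ∷ t)) * weight x k (free (v ∷ t))))
    ≡⟨ ∑-cong ts addColumn ⟩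
  ∑ ts (λ t → x * (𝟙 (valid t) * weight (1ℤ + x) k (free t) - 𝟙 (valid t) * weight x k (free t)))
    ≡⟨ ∑-difference ts x _ _ ⟩
  x * (freeRowPolynomial k hs (1ℤ + x) - freeRowPolynomial k hs x) ∎
  where
  vs = columnList k
  ts = fillingList hs

  collect : ∀ a x p q → a * (x * (p - q)) ≡ x * (a * p - a * q)
  collect = solve-∀

  addColumn : ∀ t → ∑ vs (λ v → 𝟙 (valid (v ∷ t)) * weight x k (free (v ∷ t)))
                  ≡ x * (𝟙 (valid t) * weight (1ℤ + x) k (free t) - 𝟙 (valid t) * weight x k (free t))
  addColumn t = begin
    ∑ vs (λ v → 𝟙 (valid t ∧ ok v) * weight x k (free (v ∷ t)))
      ≡⟨ ∑-cong vs (λ v → trans (cong (_* weight x k (free (v ∷ t))) (𝟙-∧ (valid t) (ok v)))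
                                (ℤ.*-assoc (𝟙 (valid t)) (𝟙 (ok v)) _)) ⟩
    ∑ vs (λ v → 𝟙 (valid t) * (𝟙 (ok v) * weight x k (free (v ∷ t))))
      ≡⟨ ∑-*ˡ vs (𝟙 (valid t)) _ ⟩
    𝟙 (valid t) * ∑ vs (λ v → 𝟙 (ok v) * weight x k (free (v ∷ t)))
      ≡⟨ cong (𝟙 (valid t) *_) (∑-columns x k (free t)) ⟩
    𝟙 (valid t) * (x * (weight (1ℤ + x) k (free t) - weight x k (free t)))
      ≡⟨ collect (𝟙 (valid t)) x _ _ ⟩
    x * (𝟙 (valid t) * weight (1ℤ + x) k (free t) - 𝟙 (valid t) * weight x k (free t)) ∎
    where
    ok : Vec (Fin 2) k → Bool
    ok v = hasOne v ∧ onesWithin (free t) v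

-- Refinement under prependOne and growHead

partialSums-positive : ∀ {ps} → All (1 ≤_) ps → All (1 ≤_) (partialSums ps)
partialSums-positive []          = []
partialSums-positive (_ ∷ [])    = []
partialSums-positive {i ∷ _} (i≥1 ∷ p ∷ ps) =
  i≥1 ∷ All.map⁺ (All.universal (λ y → ℕ.≤-trans i≥1 (ℕ.m≤m+n i y)) _)

-- Keeps the descent 1 created by `prependOne` apart from the old descents, which are shifted by
-- one.
0∉Des : ∀ {n} (I : Composition n) → ¬ (0 ∈ Des I)
0∉Des I 0∈ with () ← All.lookup (partialSums-positive (positive I)) 0∈

Des-prependOne : ∀ {n} (I : Composition (suc n)) → Des (prependOne I) ≡ 1 ∷ map suc (Des I)
Des-prependOne (mkComposition (i ∷ is) _ _) = refl

Des-growHead : ∀ {n} (I : Composition (suc n)) → Des (growHead I) ≡ map suc (Des I)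
Des-growHead (mkComposition (i ∷ [])     (_ ∷ _) _) = refl
Des-growHead (mkComposition (i ∷ j ∷ js) (_ ∷ _) _) = cong (suc i ∷_) (map-∘ (partialSums (j ∷ js)))

ℓ-growHead : ∀ {n} (I : Composition (suc n)) → ℓ (growHead I) ≡ ℓ I
ℓ-growHead (mkComposition (i ∷ is) (_ ∷ _) _) = refl

map-suc-⊆⁻ : ∀ {xs ys} → map suc xs ⊆ map suc ys → xs ⊆ ys
map-suc-⊆⁻ sub x∈ with y , y∈ , refl ← ∈-map⁻ suc (sub (∈-map⁺ suc x∈)) = y∈

map-suc-⊆1∷⁻ : ∀ {xs ys} → ¬ (0 ∈ xs) → map suc xs ⊆ 1 ∷ map suc ys → xs ⊆ ys
map-suc-⊆1∷⁻ 0∉xs sub x∈ with sub (∈-map⁺ suc x∈)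
... | here refl = contradiction x∈ 0∉xs
... | there p with y , y∈ , refl ← ∈-map⁻ suc p = y∈

1∷map-suc-⊆⁺ : ∀ {xs ys} → xs ⊆ ys → 1 ∷ map suc xs ⊆ 1 ∷ map suc ys
1∷map-suc-⊆⁺ {xs} {ys} sub = ∷⁺ʳ 1 (map⁺ {xs = xs} {ys = ys} suc sub)

module _ {n} (I J : Composition (suc n)) where

  -- Both moves shift the descent set by one, and `prependOne` also inserts 1. A comparison after
  -- the moves therefore reduces to one before them, unless 1 is a descent on the coarser side only.
  prependOne⪰prependOne : prependOne J ⪰ prependOne I ⇔ J ⪰ I
  prependOne⪰prependOne rewrite Des-prependOne I | Des-prependOne J =
    mk⇔ {B = J ⪰ I} (λ sub → map-suc-⊆1∷⁻ (0∉Des J) (λ x∈ → sub (there x∈))) (1∷map-suc-⊆⁺ {Des J} {Des I})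

  growHead⪰prependOne : growHead J ⪰ prependOne I ⇔ J ⪰ I
  growHead⪰prependOne rewrite Des-prependOne I | Des-growHead J =
    mk⇔ {B = J ⪰ I} (map-suc-⊆1∷⁻ (0∉Des J)) (λ sub x∈ → 1∷map-suc-⊆⁺ {Des J} {Des I} sub (there x∈))

  growHead⪰growHead : growHead J ⪰ growHead I ⇔ J ⪰ I
  growHead⪰growHead rewrite Des-growHead I | Des-growHead J =
    mk⇔ {B = J ⪰ I} map-suc-⊆⁻ (map⁺ suc)

  prependOne⋡growHead : ¬ (prependOne J ⪰ growHead I)
  prependOne⋡growHead rewrite Des-growHead I | Des-prependOne J = λ sub → oneNotIn (sub (here refl))
    where
    oneNotIn : ¬ (1 ∈ map suc (Des I))
    oneNotIn 1∈ with .0 , 0∈ , refl ← ∈-map⁻ suc 1∈ = 0∉Des I 0∈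

data HeadView {n} : Composition (suc (suc n)) → Set where
  prepended : ∀ I → HeadView (prependOne I)
  grown     : ∀ I → HeadView (growHead I)

-- Read off from the complete enumeration, which is the concatenation of the two images. On shapes,
-- `prependOne` adds an empty top row and `growHead` a leftmost column of full height.
headView : ∀ {n} (I : Composition (suc (suc n))) → HeadView I
headView {n} I with ∈-++⁻ (map prependOne (compositionList (suc n))) (complete (compositions (suc (suc n))) I)
... | inj₁ p with J , _ , refl ← ∈-map⁻ prependOne p = prepended J
... | inj₂ p with J , _ , refl ← ∈-map⁻ growHead p   = grown J

-- Ensures that the truncated subtraction in the sign exponent is a true difference for every `J`
-- that is summed.
⪰⇒ℓ≤ : ∀ {n} (I J : Composition (suc n)) → J ⪰ I → ℓ J ≤ ℓ I
⪰⇒ℓ≤ {zero} I J _ with here refl ← complete (compositions 1) I | here refl ← complete (compositions 1) J = ℕ.≤-refl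
⪰⇒ℓ≤ {suc n} I J J⪰I with headView I | headView J
... | prepended I′ | prepended J′ = s≤s (⪰⇒ℓ≤ I′ J′ (to (prependOne⪰prependOne I′ J′) J⪰I))
... | prepended I′ | grown J′     = subst (_≤ suc (ℓ I′)) (sym (ℓ-growHead J′))
  (ℕ.m≤n⇒m≤1+n (⪰⇒ℓ≤ I′ J′ (to (growHead⪰prependOne I′ J′) J⪰I)))
... | grown I′     | prepended J′ = ⊥-elim (prependOne⋡growHead I′ J′ J⪰I)
... | grown I′     | grown J′     rewrite ℓ-growHead I′ | ℓ-growHead J′ =
  ⪰⇒ℓ≤ I′ J′ (to (growHead⪰growHead I′ J′) J⪰I)

-- Expansion in rising factorials

-- The lowest factor is peeled off, so that E R_p = R_(p+1) holds by definition.
rising : ℤ → ℕ → ℤ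
rising x zero    = 1ℤ
rising x (suc p) = x * rising (1ℤ + x) p

-- Peels off the highest factor instead. Comparing the two forms gives x R_p(x+1) - x R_p(x) = p
-- R_p(x), that is, D R_p = p R_p.
rising-suc : ∀ x p → rising x (suc p) ≡ rising x p * (x + + p)
rising-suc x zero    = base x
  where
  base : ∀ x → x * 1ℤ ≡ 1ℤ * (x + 0ℤ)
  base = solve-∀
rising-suc x (suc p) = begin
  x * rising (1ℤ + x) (suc p)                 ≡⟨ cong (x *_) (rising-suc (1ℤ + x) p) ⟩
  x * (rising (1ℤ + x) p * (1ℤ + x + + p))    ≡⟨ shift x (rising (1ℤ + x) p) (+ p) ⟩
  x * rising (1ℤ + x) p * (x + (1ℤ + + p))    ∎
  where
  shift : ∀ x r p → x * (r * (1ℤ + x + p)) ≡ x * r * (x + (1ℤ + p))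
  shift = solve-∀

rising-one : ∀ p → rising 1ℤ p ≡ + (p !)
rising-one zero    = refl
rising-one (suc p) = begin
  rising 1ℤ (suc p)         ≡⟨ rising-suc 1ℤ p ⟩
  rising 1ℤ p * + suc p     ≡⟨ cong (_* + suc p) (rising-one p) ⟩
  + (p !) * + suc p         ≡⟨ ℤ.*-comm (+ (p !)) (+ suc p) ⟩
  + suc p * + (p !)         ≡⟨ ℤ.pos-* (suc p) (p !) ⟨
  + (suc p !)               ∎

-- The exponents are j - 1, so that Fact J is this product times ℓ(J)!.
reducedFact : List ℕ → ℕ
reducedFact []       = 1
reducedFact (j ∷ js) = length (j ∷ js) ℕ.^ (j ∸ 1) ℕ.* reducedFact js

-- Each part gives up one copy of its base, and the bases run down from the number of parts to 1.
factParts-reducedFact : ∀ {js} → All (1 ≤_) js → factParts js ≡ reducedFact js ℕ.* length js !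
factParts-reducedFact []                      = refl
factParts-reducedFact {suc j ∷ js} (_ ∷ js≥1) =
  trans (cong (k ℕ.* k ℕ.^ j ℕ.*_) (factParts-reducedFact js≥1))
        (rearrange k (k ℕ.^ j) (reducedFact js) (length js !))
  where
  k = suc (length js)

  rearrange : ∀ a b c d → a ℕ.* b ℕ.* (c ℕ.* d) ≡ b ℕ.* c ℕ.* (a ℕ.* d)
  rearrange = ℕ-Solver.solve-∀

-- The first base is `ℓ J`, so one more copy of it supplies the eigenvalue of D on R_p with p =
-- `ℓ J`.
reducedFact-growHead : ∀ {n} (J : Composition (suc n)) →
                       reducedFact (parts (growHead J)) ≡ ℓ J ℕ.* reducedFact (parts J)
reducedFact-growHead (mkComposition (suc j ∷ js) (_ ∷ _) _) =
  ℕ.*-assoc (suc (length js)) (suc (length js) ℕ.^ j) (reducedFact js)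

summand : ∀ {n} → ℤ → Composition n → Composition n → ℤ
summand x I J = -1ℤ ^ (ℓ I ∸ ℓ J) * (+ reducedFact (parts J) * rising x (ℓ J))

summand-one : ∀ {n} (I J : Composition n) → summand 1ℤ I J ≡ -1ℤ ^ (ℓ I ∸ ℓ J) * + Fact J
summand-one I J = cong (-1ℤ ^ (ℓ I ∸ ℓ J) *_) (begin
  + reducedFact (parts J) * rising 1ℤ (ℓ J)    ≡⟨ cong (+ reducedFact (parts J) *_) (rising-one (ℓ J)) ⟩
  + reducedFact (parts J) * + (ℓ J !)          ≡⟨ ℤ.pos-* (reducedFact (parts J)) (ℓ J !) ⟨
  + (reducedFact (parts J) ℕ.* ℓ J !)          ≡⟨ cong +_ (factParts-reducedFact (positive J)) ⟨
  + Fact J                                     ∎)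

-- The condition is an indicator rather than a filter, so that the sums over prepended and over
-- grown `J` run over the same list and can be combined term by term.
coarseningSum : ∀ {n} → Composition n → ℤ → ℤ
coarseningSum {n} I x = ∑ (compositionList n) (λ J → 𝟙 (does (coarser? I J)) * summand x I J)

module _ {n} (I J : Composition (suc n)) (x : ℤ) where

  private
    e = 𝟙 (does (coarser? I J))
    s = -1ℤ ^ (ℓ I ∸ ℓ J)
    r = + reducedFact (parts J)
    p = + ℓ J
    R = rising x (ℓ J)

    -- The length `m` is left open because it is needed for both `prependOne I` and `growHead I`.
    growHead-factors : ∀ m → -1ℤ ^ (m ∸ ℓ (growHead J)) * (+ reducedFact (parts (growHead J)) * rising x (ℓ (growHead J)))
                     ≡ -1ℤ ^ (m ∸ ℓ J) * (p * r * R)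
    growHead-factors m = cong₂ (λ q f → -1ℤ ^ (m ∸ q) * (f * rising x q)) (ℓ-growHead J)
      (trans (cong +_ (reducedFact-growHead J)) (ℤ.pos-* (ℓ J) (reducedFact (parts J))))

  -- X = E - D on the rising factorial R of degree p.
  prependOne-summands :
    𝟙 (does (coarser? (prependOne I) (prependOne J))) * summand x (prependOne I) (prependOne J) +
    𝟙 (does (coarser? (prependOne I) (growHead J))) * summand x (prependOne I) (growHead J)
      ≡ x * (e * summand x I J)
  prependOne-summands = begin
    𝟙 (does (coarser? (prependOne I) (prependOne J))) * summand x (prependOne I) (prependOne J) +
    𝟙 (does (coarser? (prependOne I) (growHead J))) * summand x (prependOne I) (growHead J)
      ≡⟨ cong₂ _+_ prepended-term grown-term ⟩
    e * (s * (r * (R * (x + p)))) + e * (-1ℤ * s * (p * r * R))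
      -- The terms in `p` cancel: (x + p) - p = x.
      ≡⟨ collect e s r p R x ⟩
    x * (e * (s * (r * R))) ∎
    where
    prepended-term : 𝟙 (does (coarser? (prependOne I) (prependOne J))) * summand x (prependOne I) (prependOne J)
                   ≡ e * (s * (r * (R * (x + p))))
    prepended-term = cong₂ (λ b y → 𝟙 b * (s * y))
      (does-⇔ (prependOne⪰prependOne I J) (coarser? (prependOne I) (prependOne J)) (coarser? I J))
      (cong₂ _*_ (cong +_ (ℕ.*-identityˡ (reducedFact (parts J)))) (rising-suc x (ℓ J)))

    grown-term : 𝟙 (does (coarser? (prependOne I) (growHead J))) * summand x (prependOne I) (growHead J)
               ≡ e * (-1ℤ * s * (p * r * R))
    grown-term = trans
      (cong₂ (λ b y → 𝟙 b * y)
        (does-⇔ (growHead⪰prependOne I J) (coarser? (prependOne I) (growHead J)) (coarser? I J))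
        (growHead-factors (suc (ℓ I))))
      -- The finer composition gains a part while `ℓ J` is unchanged, so the sign flips. Pulling out
      -- the 1 needs `ℓ J ≤ ℓ I`, available only where the indicator is nonzero.
      (𝟙-*-cong (coarser? I J) (λ J⪰I →
        cong (λ m → -1ℤ ^ m * (p * r * R)) (ℕ.+-∸-assoc 1 (⪰⇒ℓ≤ I J J⪰I))))

    collect : ∀ e s r p R x → e * (s * (r * (R * (x + p)))) + e * (-1ℤ * s * (p * r * R)) ≡ x * (e * (s * (r * R)))
    collect = solve-∀

  prependOne-growHead-summand :
    𝟙 (does (coarser? (growHead I) (prependOne J))) * summand x (growHead I) (prependOne J) ≡ 0ℤ
  prependOne-growHead-summand =
    trans (𝟙-*-cong (coarser? (growHead I) (prependOne J)) (λ J⪰I → ⊥-elim (prependOne⋡growHead I J J⪰I)))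
          (ℤ.*-zeroʳ (𝟙 (does (coarser? (growHead I) (prependOne J)))))

  -- The relation D R_p = p R_p read from right to left: `p` is written as (x + p) - x, and
  -- `rising-suc` turns `R * (x + p)` into `x * R⁺`.
  growHead-summand :
    𝟙 (does (coarser? (growHead I) (growHead J))) * summand x (growHead I) (growHead J)
      ≡ x * (e * summand (1ℤ + x) I J - e * summand x I J)
  growHead-summand = begin
    𝟙 (does (coarser? (growHead I) (growHead J))) * summand x (growHead I) (growHead J)
      ≡⟨ cong₂ (λ b y → 𝟙 b * y)
           (does-⇔ (growHead⪰growHead I J) (coarser? (growHead I) (growHead J)) (coarser? I J))
           (trans (growHead-factors (ℓ (growHead I))) (cong (λ m → -1ℤ ^ (m ∸ ℓ J) * (p * r * R)) (ℓ-growHead I))) ⟩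
    e * (s * (p * r * R))
      ≡⟨ expand e s r p R x ⟩
    e * (s * (r * (R * (x + p)))) - x * (e * (s * (r * R)))
      ≡⟨ cong (λ y → e * (s * (r * y)) - x * (e * (s * (r * R)))) (rising-suc x (ℓ J)) ⟨
    e * (s * (r * (x * R⁺))) - x * (e * (s * (r * R)))
      ≡⟨ collect e s r R⁺ R x ⟩
    x * (e * (s * (r * R⁺)) - e * (s * (r * R))) ∎
    where
    R⁺ = rising (1ℤ + x) (ℓ J)

    expand : ∀ e s r p R x → e * (s * (p * r * R)) ≡ e * (s * (r * (R * (x + p)))) - x * (e * (s * (r * R)))
    expand = solve-∀

    collect : ∀ e s r R⁺ R x → e * (s * (r * (x * R⁺))) - x * (e * (s * (r * R))) ≡ x * (e * (s * (r * R⁺)) - e * (s * (r * R)))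
    collect = solve-∀

coarseningSum-split : ∀ {n} (I : Composition (suc (suc n))) x →
  coarseningSum I x ≡
    ∑ (compositionList (suc n)) (λ J → 𝟙 (does (coarser? I (prependOne J))) * summand x I (prependOne J)) +
    ∑ (compositionList (suc n)) (λ J → 𝟙 (does (coarser? I (growHead J))) * summand x I (growHead J))
coarseningSum-split {n} I x =
  trans (∑-++ (map prependOne L) (map growHead L) f) (cong₂ _+_ (∑-map prependOne L f) (∑-map growHead L f))
  where
  L = compositionList (suc n)

  f : Composition (suc (suc n)) → ℤ
  f J = 𝟙 (does (coarser? I J)) * summand x I J

coarseningSum-prependOne : ∀ {n} (I : Composition (suc n)) x →
                           coarseningSum (prependOne I) x ≡ x * coarseningSum I x
coarseningSum-prependOne {n} I x = begin
  coarseningSum (prependOne I) x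
    ≡⟨ coarseningSum-split (prependOne I) x ⟩
  ∑ L f + ∑ L g
    ≡⟨ ∑-+ L f g ⟨
  ∑ L (λ J → f J + g J)
    ≡⟨ ∑-cong L (λ J → prependOne-summands I J x) ⟩
  ∑ L (λ J → x * (𝟙 (does (coarser? I J)) * summand x I J))
    ≡⟨ ∑-*ˡ L x (λ J → 𝟙 (does (coarser? I J)) * summand x I J) ⟩
  x * coarseningSum I x ∎
  where
  L = compositionList (suc n)

  f g : Composition (suc n) → ℤ
  f J = 𝟙 (does (coarser? (prependOne I) (prependOne J))) * summand x (prependOne I) (prependOne J)
  g J = 𝟙 (does (coarser? (prependOne I) (growHead J))) * summand x (prependOne I) (growHead J)

coarseningSum-growHead : ∀ {n} (I : Composition (suc n)) x →
                         coarseningSum (growHead I) x ≡ x * (coarseningSum I (1ℤ + x) - coarseningSum I x)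
coarseningSum-growHead {n} I x = begin
  coarseningSum (growHead I) x
    ≡⟨ coarseningSum-split (growHead I) x ⟩
  ∑ L f + ∑ L g
    -- 1 is not a descent of `growHead I`, so no prepended `J` survives.
    ≡⟨ cong₂ _+_ (trans (∑-cong L (λ J → prependOne-growHead-summand I J x)) (∑-zero L))
                 (∑-cong L (λ J → growHead-summand I J x)) ⟩
  0ℤ + ∑ L (λ J → x * (h (1ℤ + x) J - h x J))
    ≡⟨ ℤ.+-identityˡ _ ⟩
  ∑ L (λ J → x * (h (1ℤ + x) J - h x J))
    ≡⟨ ∑-difference L x (h (1ℤ + x)) (h x) ⟩
  x * (coarseningSum I (1ℤ + x) - coarseningSum I x) ∎
  where
  L = compositionList (suc n)

  f g : Composition (suc n) → ℤ
  f J = 𝟙 (does (coarser? (growHead I) (prependOne J))) * summand x (growHead I) (prependOne J)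
  g J = 𝟙 (does (coarser? (growHead I) (growHead J))) * summand x (growHead I) (growHead J)

  h : ℤ → Composition (suc n) → ℤ
  h y J = 𝟙 (does (coarser? I J)) * summand y I J

-- Equality of the two polynomials

tableauPolynomial : ∀ {n} → Composition n → ℤ → ℤ
tableauPolynomial I = freeRowPolynomial (ℓ I) (columns (shape I))

-- A leading part 1 asks for zero columns of the new full height, so the list of columns is
-- unchanged by computation.
tableauPolynomial-prependOne : ∀ {n} (I : Composition n) x →
                               tableauPolynomial (prependOne I) x ≡ x * tableauPolynomial I x
tableauPolynomial-prependOne I x = freeRowPolynomial-emptyRow (ℓ I) x (fits (shape I))

tableauPolynomial-growHead : ∀ {n} (I : Composition (suc n)) x →
  tableauPolynomial (growHead I) x ≡ x * (tableauPolynomial I (1ℤ + x) - tableauPolynomial I x)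
tableauPolynomial-growHead (mkComposition (suc i ∷ is) (_ ∷ _) _) x =
  freeRowPolynomial-column (suc (length is)) (columnLengths (suc i ∷ is)) x

-- Both sides obey the same two recurrences. The point `x` stays general, since the case of
-- `growHead` uses the induction hypothesis at `1ℤ + x` as well.
tableauPolynomial-coarseningSum : ∀ {n} (I : Composition (suc n)) x → tableauPolynomial I x ≡ coarseningSum I x
-- For the only composition of 1, both sides are the polynomial x.
tableauPolynomial-coarseningSum {zero}  I x with here refl ← complete (compositions 1) I = base x
  where
  base : ∀ x → 1ℤ * (x * 1ℤ) + 0ℤ ≡ 1ℤ * (1ℤ * (1ℤ * (x * 1ℤ))) + 0ℤ
  base = solve-∀
tableauPolynomial-coarseningSum {suc n} I x with headView I
... | prepended I′ = begin
  tableauPolynomial (prependOne I′) x    ≡⟨ tableauPolynomial-prependOne I′ x ⟩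
  x * tableauPolynomial I′ x             ≡⟨ cong (x *_) (tableauPolynomial-coarseningSum I′ x) ⟩
  x * coarseningSum I′ x                 ≡⟨ coarseningSum-prependOne I′ x ⟨
  coarseningSum (prependOne I′) x        ∎
... | grown I′ = begin
  tableauPolynomial (growHead I′) x
    ≡⟨ tableauPolynomial-growHead I′ x ⟩
  x * (tableauPolynomial I′ (1ℤ + x) - tableauPolynomial I′ x)
    ≡⟨ cong₂ (λ y z → x * (y - z)) (tableauPolynomial-coarseningSum I′ (1ℤ + x)) (tableauPolynomial-coarseningSum I′ x) ⟩
  x * (coarseningSum I′ (1ℤ + x) - coarseningSum I′ x)
    ≡⟨ coarseningSum-growHead I′ x ⟨
  coarseningSum (growHead I′) x ∎

-- At 1 every weight is 1, so only the indicator of validity is left to sum.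
PTᴬ-tableauPolynomial : ∀ {n} (I : Composition n) → + PTᴬ I ≡ tableauPolynomial I 1ℤ
PTᴬ-tableauPolynomial I = begin
  + PTᴬ I
    ≡⟨ length-filter (isPermutationTableau? (shape I)) ts ⟩
  ∑ ts (λ t → 𝟙 (does (isPermutationTableau? (shape I) t)))
    ≡⟨ ∑-cong ts (λ t → cong 𝟙 (isPermutationTableau-valid (shape I) t)) ⟩
  ∑ ts (λ t → 𝟙 (valid t))
    ≡⟨ ∑-cong ts (λ t → trans (cong (𝟙 (valid t) *_) (weight-one (ℓ I) (free t))) (ℤ.*-identityʳ (𝟙 (valid t)))) ⟨
  tableauPolynomial I 1ℤ ∎
  where
  ts = fillingList (columns (shape I))

mainTheorem2 : (n : ℕ) → 1 ≤ n → (I : Composition n) →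
    + PTᴬ I ≡ ∑⪰ I (λ J → -1ℤ ^ (ℓ I ∸ ℓ J) * + Fact J)
mainTheorem2 (suc n) _ I = begin
  + PTᴬ I
    ≡⟨ PTᴬ-tableauPolynomial I ⟩
  tableauPolynomial I 1ℤ
    ≡⟨ tableauPolynomial-coarseningSum I 1ℤ ⟩
  coarseningSum I 1ℤ
    ≡⟨ ∑-filter (coarser? I) (compositionList (suc n)) (summand 1ℤ I) ⟨
  ∑⪰ I (summand 1ℤ I)
    ≡⟨ ∑-cong (filter (coarser? I) (compositionList (suc n))) (summand-one I) ⟩
  ∑⪰ I (λ J → -1ℤ ^ (ℓ I ∸ ℓ J) * + Fact J) ∎
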